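{- Let $\langle X,\tau,T\rangle$ be a conditional space and $\mathrm{Cm}=\langle\mathcal{P}(X),\to_T\rangle$ its full complex algebra. With $x,y,z$ ranging over $X$ and $Y,Z$ over closed subsets of $X$, and the inequalities in $\mathrm{Cm}$ holding for all elements: (T3*) $(a\to c)\wedge(b\to c)\le(a\vee b)\to c$ holds in $\mathrm{Cm}$ iff for all $x,y$ and nonempty $Y$, $T(x,Y,y)$ implies there is $z\in Y$ with $T(x,\{z\},y)$; (T4) $a\to b\le c\to(a\to b)$ holds in $\mathrm{Cm}$ iff $T(x,Y,y)$ and $T(y,Z,z)$ imply $T(x,Z,z)$; (T5) $a\wedge(a\to b)\le b$ holds in $\mathrm{Cm}$ iff $T(x,\{x\},x)$ for all $x$; (T6) $a\to b\le\neg b\to\neg a$ holds in $\mathrm{Cm}$ iff $T(x,Y,y)$ implies there is $z\in Y$ with $T(x,\{y\},z)$; (T7) $\neg(a\to b)\le c\to\neg(a\to b)$ holds in $\mathrm{Cm}$ iff $T(x,Y,y)$ and $T(x,Z,z)$ imply $T(y,Z,z)$; (T8) $(1\to(\neg a\vee b))\wedge(b\to c)\le a\to c$ holds in $\mathrm{Cm}$ iff for all $x,y,Y,Z$: $T(x,Y,y)$ and $T(x,X)\cap Y\subseteq Z$ imply $T(x,Z,y)$.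
   Context: A conditional space is $\langle X,\tau,T\rangle$ with $\langle X,\tau\rangle$ a Boolean (compact, Hausdorff, zero-dimensional) space and $T\subseteq X\times\mathcal{C}(\tau)\times X$ ($\mathcal{C}(\tau)$ the closed sets) satisfying: (T1) $T(x,Y)=\{y:T(x,Y,y)\}$ is closed for all $x$ and closed $Y$; (T2) for clopen $U,V$, $U\to_T V$ is clopen; (T3) for closed $Y$, $T(x,Y,y)$ iff $T(x,U,y)$ for all clopen $U\supseteq Y$. For any $U,V\subseteq X$, $U\to_T V=\{x\in X:\text{for all closed } Z\subseteq U,\ T(x,Z)\subseteq V\}$. In $\mathrm{Cm}$, $\wedge,\vee,\neg,1$ are intersection, union, complement and $X$. -}

module Defs where

open import Axiom.ExcludedMiddle using (ExcludedMiddle)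
open import Data.Empty using (⊥-elim)
open import Data.List.Base using (List)
open import Data.List.Relation.Unary.Any using (Any)
open import Data.Product.Base using (Σ; ∃; ∃₂; _×_; _,_; proj₁; proj₂)
open import Data.Unit.Polymorphic.Base using (tt)
open import Function.Bundles using (_⇔_)
open import Level using (Level; Lift; suc; _⊔_)
open import Relation.Binary.PropositionalEquality.Core using (_≢_; refl)
open import Relation.Nullary.Decidable using (True)
open import Relation.Unary using (Pred; _∈_; _∉_; _⊆_; _≐_; _∩_; _∪_; ∁; ⋃; ｛_｝)
open import Relation.Unary.Polymorphic using (∅; U)

-- The powerset of X : Set ℓ is Pred X ℓ, with _≐_ as equality of subsets.
-- Excluded middle makes this independent of the level: every predicate on X is
-- equivalent to a Bool-valued one.  For the same reason, families indexed by
-- types in Set ℓ account for all sets of subsets, X → Bool being in Set ℓ.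

record TopologicalSpace (ℓ : Level) : Set (suc ℓ) where
  field
    Carrier : Set ℓ
    IsOpen  : Pred (Pred Carrier ℓ) ℓ
    open-resp-≐ : ∀ {A B : Pred Carrier ℓ} → A ≐ B → IsOpen A → IsOpen B
    ∅-open  : IsOpen ∅
    U-open  : IsOpen U
    ∩-open  : ∀ {A B : Pred Carrier ℓ} → IsOpen A → IsOpen B → IsOpen (A ∩ B)
    ⋃-open  : ∀ {I : Set ℓ} (F : I → Pred Carrier ℓ) →
              (∀ i → IsOpen (F i)) → IsOpen (⋃ I F)

  IsClosed : Pred (Pred Carrier ℓ) ℓ
  IsClosed A = IsOpen (∁ A)

  IsClopen : Pred (Pred Carrier ℓ) ℓ
  IsClopen A = IsOpen A × IsClosed A

  ClosedSet : Set (suc ℓ)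
  ClosedSet = Σ (Pred Carrier ℓ) IsClosed

  ∣_∣ : ClosedSet → Pred Carrier ℓ
  ∣_∣ = proj₁

  Compact : Set (suc ℓ)
  Compact = ∀ {I : Set ℓ} (F : I → Pred Carrier ℓ) → (∀ i → IsOpen (F i)) →
            (∀ x → x ∈ ⋃ I F) →
            ∃ λ (is : List I) → ∀ x → Any (λ i → x ∈ F i) is

  Hausdorff : Set (suc ℓ)
  Hausdorff = ∀ {x y} → x ≢ y →
              ∃₂ λ (A B : Pred Carrier ℓ) →
              IsOpen A × IsOpen B × x ∈ A × y ∈ B × (∀ z → z ∈ A → z ∉ B)

  ZeroDimensional : Set (suc ℓ)
  ZeroDimensional = ∀ {x} {A : Pred Carrier ℓ} → IsOpen A → x ∈ A →
                    ∃ λ (B : Pred Carrier ℓ) → IsClopen B × x ∈ B × B ⊆ A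

record BooleanSpace (ℓ : Level) : Set (suc ℓ) where
  field
    topologicalSpace : TopologicalSpace ℓ
  open TopologicalSpace topologicalSpace public
  field
    compact         : Compact
    hausdorff       : Hausdorff
    zeroDimensional : ZeroDimensional

  whole : ClosedSet
  whole = U , open-resp-≐ ((λ ()) , λ ¬tt → ⊥-elim (¬tt tt)) ∅-open

  singleton : Carrier → ClosedSet
  singleton x = ｛ x ｝ , open-resp-≐ (to , from) (⋃-open F F-open)
    where
    F : (∃ λ y → x ≢ y) → Pred Carrier ℓ
    F (y , x≢y) = proj₁ (proj₂ (hausdorff x≢y))

    F-open : ∀ i → IsOpen (F i)
    F-open (y , x≢y) = proj₁ (proj₂ (proj₂ (proj₂ (hausdorff x≢y))))

    to : ⋃ _ F ⊆ ∁ ｛ x ｝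
    to ((y , x≢y) , x∈B) refl with hausdorff x≢y
    ... | _ , _ , _ , _ , x∈A , _ , disjoint = disjoint x x∈A x∈B

    from : ∁ ｛ x ｝ ⊆ ⋃ _ F
    from {y} x≢y = (y , x≢y) , proj₁ (proj₂ (proj₂ (proj₂ (proj₂ (proj₂ (hausdorff x≢y))))))

record RawConditionalAlgebra (c ℓ : Level) : Set (suc (c ⊔ ℓ)) where
  infix  4 _≤_
  infixr 5 _⇒_
  infixr 6 _∨_
  infixr 7 _∧_
  infix  8 ¬_
  field
    Element : Set c
    _≤_     : Element → Element → Set ℓ
    _∧_     : Element → Element → Element
    _∨_     : Element → Element → Element
    ¬_      : Element → Element
    𝟏       : Element
    _⇒_     : Element → Element → Element

-- Excluded middle, the ambient logic of the theory, is an explicit assumption.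

module _ {ℓ : Level} (em : ExcludedMiddle (suc ℓ)) where

  -- A proposition in Set ℓ equivalent to P (by toWitness and fromWitness).
  Resize : Set (suc ℓ) → Set ℓ
  Resize P = Lift ℓ (True (em {P}))

  record ConditionalSpace : Set (suc ℓ) where
    field
      booleanSpace : BooleanSpace ℓ
    open BooleanSpace booleanSpace public
    field
      -- T x Y is the set T(x,Y).  That T depends on Y only as a subset, and not
      -- on the proof that it is closed, follows from T-approx.
      T : Carrier → ClosedSet → Pred Carrier ℓ

    -- A →_T B = {x : T(x,Z) ⊆ B for all closed Z ⊆ A}.  The quantification over
    -- closed sets lives in Set (suc ℓ); Resize brings it back to the powerset.
    infixr 5 _⇒ₜ_
    _⇒ₜ_ : Pred Carrier ℓ → Pred Carrier ℓ → Pred Carrier ℓ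
    (A ⇒ₜ B) x = Resize (∀ (Z : ClosedSet) → ∣ Z ∣ ⊆ A → T x Z ⊆ B)

    field
      T-closed : ∀ x (Y : ClosedSet) → IsClosed (T x Y)
      ⇒-clopen : ∀ {A B : Pred Carrier ℓ} → IsClopen A → IsClopen B → IsClopen (A ⇒ₜ B)
      T-approx : ∀ x (Y : ClosedSet) y →
                 T x Y y ⇔
                 (∀ (A : Pred Carrier ℓ) (A-clopen : IsClopen A) → ∣ Y ∣ ⊆ A →
                  T x (A , proj₂ A-clopen) y)

  Cm : ConditionalSpace → RawConditionalAlgebra (suc ℓ) ℓ
  Cm S = record
    { Element = Pred Carrier ℓ
    ; _≤_     = _⊆_
    ; _∧_     = _∩_
    ; _∨_     = _∪_
    ; ¬_      = ∁
    ; 𝟏       = U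
    ; _⇒_     = _⇒ₜ_
    }
    where open ConditionalSpace S

{-# OPTIONS --safe #-}

-- By (T3), T(x,Y) grows with Y, so for closed Y membership x ∈ Y → B just means
-- T(x,Y) ⊆ B; in particular x ∈ Y → X∖{y} says exactly that T(x,Y,y) fails.
-- Each frame condition is therefore the instance of its inequality at closed
-- sets and at complements of points.  Only (T3*) needs the topology: if
-- T(x,{z},y) fails for every z ∈ Y, then by (T3) each z has a clopen
-- neighbourhood A with x ∈ A → X∖{y}; finitely many of these cover Y.

module Submission where

open import Defs
open import Axiom.ExcludedMiddle using (ExcludedMiddle)
open import Data.Bool.Base using (Bool; true; false)
open import Data.Empty using (⊥; ⊥-elim)
open import Data.List.Base using ([]; _∷_; mapMaybe)
open import Data.List.Relation.Unary.Any using (Any; here; there)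
open import Data.Maybe.Base using (Maybe; just; nothing)
open import Data.Product.Base using (∃; _×_; _,_; proj₁; proj₂)
open import Data.Sum.Base using (inj₁; inj₂)
open import Function.Base using (id; _∘_)
open import Function.Bundles using (_⇔_; mk⇔; module Equivalence)
open import Level using (Level; Lift; lift; lower; suc)
open import Relation.Binary.PropositionalEquality.Core using (refl)
open import Relation.Nullary using (yes; no)
open import Relation.Nullary.Decidable using (map′; decidable-stable; toWitness; fromWitness)
open import Relation.Unary using (Pred; _∈_; _∉_; _⊆_; _∩_; _∪_; ∁; ⋃; ｛_｝; Satisfiable)
open import Relation.Unary.Polymorphic using (U)

private
  variable
    ℓ : Level

em-lower : ExcludedMiddle (suc ℓ) → ExcludedMiddle ℓ
em-lower {ℓ} em {P} = map′ lower lift (em {Lift (suc ℓ) P})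

module _ (em : ExcludedMiddle ℓ) (X : TopologicalSpace ℓ) where
  open TopologicalSpace X

  -- The binary union of the two open complements is an arbitrary union over a lifted `Bool`.
  -- Excluded middle supplies the classical half of De Morgan.
  ∩-closed : ∀ {A B} → IsClosed A → IsClosed B → IsClosed (A ∩ B)
  ∩-closed {A} {B} A-closed B-closed =
    open-resp-≐ (to , from) (⋃-open F F-open)
    where
    F : Lift ℓ Bool → Pred Carrier ℓ
    F (lift true)  = ∁ A
    F (lift false) = ∁ B

    F-open : ∀ i → IsOpen (F i)
    F-open (lift true)  = A-closed
    F-open (lift false) = B-closed

    to : ⋃ _ F ⊆ ∁ (A ∩ B)
    to (lift true  , x∉A) (x∈A , _) = x∉A x∈A
    to (lift false , x∉B) (_ , x∈B) = x∉B x∈B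

    from : ∁ (A ∩ B) ⊆ ⋃ _ F
    from {x} x∉A∩B with em {x ∈ A}
    ... | yes x∈A = lift false , λ x∈B → x∉A∩B (x∈A , x∈B)
    ... | no  x∉A = lift true , x∉A

  closed-compact : Compact → ∀ {A} → IsClosed A →
                   {I : Set ℓ} (F : I → Pred Carrier ℓ) → (∀ i → IsOpen (F i)) →
                   A ⊆ ⋃ I F → ∃ λ is → A ⊆ λ x → Any (λ i → x ∈ F i) is
  closed-compact compact {A} A-closed {I} F F-open A⊆⋃F =
    let is , covers = compact G G-open G-covers
    in mapMaybe id is , λ {x} x∈A → strip x∈A is (covers x)
    where
    G : Maybe I → Pred Carrier ℓ
    G (just i) = F i
    G nothing  = ∁ A

    G-open : ∀ i → IsOpen (G i)
    G-open (just i) = F-open i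
    G-open nothing  = A-closed

    G-covers : ∀ x → x ∈ ⋃ _ G
    G-covers x with em {x ∈ A}
    ... | yes x∈A = let i , x∈Fi = A⊆⋃F x∈A in just i , x∈Fi
    ... | no  x∉A = nothing , x∉A

    strip : ∀ {x} → x ∈ A → ∀ is → Any (λ i → x ∈ G i) is →
            Any (λ i → x ∈ F i) (mapMaybe id is)
    strip x∈A (just i  ∷ is) (here x∈Fi)  = here x∈Fi
    strip x∈A (just i  ∷ is) (there rest) = there (strip x∈A is rest)
    strip x∈A (nothing ∷ is) (here x∉A)   = ⊥-elim (x∉A x∈A)
    strip x∈A (nothing ∷ is) (there rest) = strip x∈A is rest

module _ (em : ExcludedMiddle (suc ℓ)) (S : ConditionalSpace em) where
  open ConditionalSpace S

  private
    Subset : Set (suc ℓ)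
    Subset = Pred Carrier ℓ

    em₀ : ExcludedMiddle ℓ
    em₀ = em-lower em

    by-contradiction : {P : Set ℓ} → ((P → ⊥) → ⊥) → P
    by-contradiction = decidable-stable em₀

  T-mono : ∀ {x Y Z} → ∣ Y ∣ ⊆ ∣ Z ∣ → T x Y ⊆ T x Z
  T-mono {x} {Y} {Z} Y⊆Z {y} xYy = Equivalence.from (T-approx x Z y)
    λ A A-clopen Z⊆A → Equivalence.to (T-approx x Y y) xYy A A-clopen (Z⊆A ∘ Y⊆Z)

  -- Contrapositive of (T3). The witness is sought among subsets, so double negation is removed one
  -- universe up, with `em`.
  ¬T⇒clopen : ∀ {x y} Y → y ∉ T x Y →
              ∃ λ A → ∃ λ (A-clopen : IsClopen A) →
              ∣ Y ∣ ⊆ A × y ∉ T x (A , proj₂ A-clopen)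
  ¬T⇒clopen {x} {y} Y ¬xYy = decidable-stable em λ none →
    ¬xYy (Equivalence.from (T-approx x Y y) λ A A-clopen Y⊆A →
      by-contradiction λ ¬xAy → none (A , A-clopen , (λ {_} → Y⊆A) , ¬xAy))

  ⇒-intro : ∀ {A B x} → (∀ Z → ∣ Z ∣ ⊆ A → T x Z ⊆ B) → x ∈ (A ⇒ₜ B)
  ⇒-intro {A} {B} {x} p =
    lift (fromWitness {a? = em {∀ Z → ∣ Z ∣ ⊆ A → T x Z ⊆ B}} p)

  ⇒-elim : ∀ {A B x} → x ∈ (A ⇒ₜ B) → ∀ Z → ∣ Z ∣ ⊆ A → T x Z ⊆ B
  ⇒-elim {A} {B} {x} (lift p) =
    toWitness {a? = em {∀ Z → ∣ Z ∣ ⊆ A → T x Z ⊆ B}} p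

  ⇒-anti : ∀ {A A′ B} → A ⊆ A′ → (A′ ⇒ₜ B) ⊆ (A ⇒ₜ B)
  ⇒-anti A⊆A′ p = ⇒-intro λ Z Z⊆A → ⇒-elim p Z (A⊆A′ ∘ Z⊆A)

  T⊆⇒ : ∀ {x B} Y → T x Y ⊆ B → x ∈ (∣ Y ∣ ⇒ₜ B)
  T⊆⇒ Y xY⊆B = ⇒-intro λ Z Z⊆Y → xY⊆B ∘ T-mono {Y = Z} {Z = Y} Z⊆Y

  ¬T⇒∁ : ∀ {x y} Y → y ∉ T x Y → x ∈ (∣ Y ∣ ⇒ₜ ∁ ｛ y ｝)
  ¬T⇒∁ Y ¬xYy = T⊆⇒ Y λ { xYy refl → ¬xYy xYy }

  ∁⇒¬T : ∀ {x y} Y → x ∈ (∣ Y ∣ ⇒ₜ ∁ ｛ y ｝) → y ∉ T x Y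
  ∁⇒¬T Y p xYy = ⇒-elim p Y id xYy refl

  ∈⇒singleton⊆ : ∀ {z} {A : Subset} → z ∈ A → ∣ singleton z ∣ ⊆ A
  ∈⇒singleton⊆ z∈A refl = z∈A

  -- The accumulator A excludes the empty union, for which the claim may fail.
  ⇒-finite-∪ : (∀ a b c → (a ⇒ₜ c) ∩ (b ⇒ₜ c) ⊆ ((a ∪ b) ⇒ₜ c)) →
               ∀ {x} {A C : Subset} {I : Set ℓ} (F : I → Subset) →
               x ∈ (A ⇒ₜ C) → (∀ i → x ∈ (F i ⇒ₜ C)) →
               ∀ is → x ∈ ((A ∪ λ w → Any (λ i → w ∈ F i) is) ⇒ₜ C)
  ⇒-finite-∪ ineq F p ps [] = ⇒-anti (λ { (inj₁ w∈A) → w∈A ; (inj₂ ()) }) p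
  ⇒-finite-∪ ineq F p ps (i ∷ is) =
    ⇒-anti
      (λ { (inj₁ w∈A)          → inj₂ (inj₁ w∈A)
         ; (inj₂ (here w∈Fi))  → inj₁ w∈Fi
         ; (inj₂ (there rest)) → inj₂ (inj₂ rest) })
      (ineq _ _ _ (ps i , ⇒-finite-∪ ineq F p ps is))

  T3* : (∀ a b c → (a ⇒ₜ c) ∩ (b ⇒ₜ c) ⊆ ((a ∪ b) ⇒ₜ c)) ⇔
        (∀ x y Y → Satisfiable ∣ Y ∣ → T x Y y →
         ∃ λ z → z ∈ ∣ Y ∣ × T x (singleton z) y)
  T3* = mk⇔ to from
    where
    to : (∀ a b c → (a ⇒ₜ c) ∩ (b ⇒ₜ c) ⊆ ((a ∪ b) ⇒ₜ c)) →
         ∀ x y Y → Satisfiable ∣ Y ∣ → T x Y y →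
         ∃ λ z → z ∈ ∣ Y ∣ × T x (singleton z) y
    to ineq x y Y (z₀ , z₀∈Y) xYy = by-contradiction λ none →
      let
        ¬xzy : ((z , _) : ∃ λ z → z ∈ ∣ Y ∣) → y ∉ T x (singleton z)
        ¬xzy (z , z∈Y) xzy = none (z , z∈Y , xzy)

        nbhd = λ i → ¬T⇒clopen (singleton (proj₁ i)) (¬xzy i)

        F : (∃ λ z → z ∈ ∣ Y ∣) → Subset
        F i = proj₁ (nbhd i)

        F-clopen : ∀ i → IsClopen (F i)
        F-clopen i = proj₁ (proj₂ (nbhd i))

        is , Y⊆is = closed-compact em₀ topologicalSpace compact (proj₂ Y)
          F (proj₁ ∘ F-clopen)
          λ z∈Y → (_ , z∈Y) , proj₁ (proj₂ (proj₂ (nbhd (_ , z∈Y)))) refl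

        -- The accumulator is the singleton of `z₀`; this is where nonemptiness of `Y` enters. Each
        -- `F i`, being clopen, is itself a closed argument for `T`.
        x∈⋃⇒ = ⇒-finite-∪ ineq F
          (¬T⇒∁ (singleton z₀) (¬xzy (z₀ , z₀∈Y)))
          (λ i → ¬T⇒∁ (F i , proj₂ (F-clopen i)) (proj₂ (proj₂ (proj₂ (nbhd i)))))
          is
      in ∁⇒¬T Y (⇒-anti (inj₂ ∘ Y⊆is) x∈⋃⇒) xYy

    from : (∀ x y Y → Satisfiable ∣ Y ∣ → T x Y y →
            ∃ λ z → z ∈ ∣ Y ∣ × T x (singleton z) y) →
           ∀ a b c → (a ⇒ₜ c) ∩ (b ⇒ₜ c) ⊆ ((a ∪ b) ⇒ₜ c)
    from cond a b c {x} (p , q) = ⇒-intro below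
      where
      below : ∀ Z → ∣ Z ∣ ⊆ a ∪ b → T x Z ⊆ c
      below Z Z⊆a∪b {y} xZy with em₀ {Satisfiable ∣ Z ∣}
      -- The condition is silent on empty `Z`, but such a `Z` lies inside `a` vacuously.
      ... | no  empty = ⇒-elim p Z (λ z∈Z → ⊥-elim (empty (_ , z∈Z))) xZy
      ... | yes inhabited with cond x y Z inhabited xZy
      ... | z , z∈Z , xzy with Z⊆a∪b z∈Z
      ... | inj₁ z∈a = ⇒-elim p (singleton z) (∈⇒singleton⊆ z∈a) xzy
      ... | inj₂ z∈b = ⇒-elim q (singleton z) (∈⇒singleton⊆ z∈b) xzy

  T4 : (∀ a b c → (a ⇒ₜ b) ⊆ (c ⇒ₜ (a ⇒ₜ b))) ⇔
       (∀ x y z Y Z → T x Y y → T y Z z → T x Z z)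
  T4 = mk⇔
    (λ ineq x y z Y Z xYy yZz → by-contradiction λ ¬xZz →
      -- Instance: `a` is `Z`, `b` the complement of `z`, `c` is `Y`.
      ∁⇒¬T Z (⇒-elim (ineq _ _ _ (¬T⇒∁ Z ¬xZz)) Y id xYy) yZz)
    (λ cond a b c {x} p → ⇒-intro λ Y _ xYy → ⇒-intro λ Z Z⊆a yZz →
      ⇒-elim p Z Z⊆a (cond _ _ _ Y Z xYy yZz))

  T5 : (∀ a b → a ∩ (a ⇒ₜ b) ⊆ b) ⇔ (∀ x → T x (singleton x) x)
  T5 = mk⇔
    (λ ineq x → by-contradiction λ ¬xxx →
      -- With `a` the singleton of `x` and `b` its complement, the inequality would put `x` outside
      -- its own singleton.
      ineq _ _ (refl , ¬T⇒∁ (singleton x) ¬xxx) refl)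
    (λ cond a b {x} (x∈a , p) →
      ⇒-elim p (singleton x) (∈⇒singleton⊆ x∈a) (cond x))

  T6 : (∀ a b → (a ⇒ₜ b) ⊆ (∁ b ⇒ₜ ∁ a)) ⇔
       (∀ x y Y → T x Y y → ∃ λ z → z ∈ ∣ Y ∣ × T x (singleton y) z)
  T6 = mk⇔
    (λ ineq x y Y xYy → by-contradiction λ none →
      -- Instance: `a` is the singleton of `y` and `b` the complement of `Y`, so that `Y` lies
      -- inside `∁ b`.
      ⇒-elim (ineq _ (∁ ∣ Y ∣) (T⊆⇒ (singleton y) λ xyz z∈Y → none (_ , z∈Y , xyz)))
        Y (λ z∈Y z∉Y → z∉Y z∈Y) xYy refl)
    (λ cond a b {x} p → ⇒-intro λ Z Z⊆∁b {y} xZy y∈a →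
      let z , z∈Z , xyz = cond x y Z xZy
      -- The point `z` lies outside `b` as a member of `Z`, yet inside `b` because `p` applies to
      -- the singleton of `y`.
      in Z⊆∁b z∈Z (⇒-elim p (singleton y) (∈⇒singleton⊆ y∈a) xyz))

  T7 : (∀ a b c → ∁ (a ⇒ₜ b) ⊆ (c ⇒ₜ ∁ (a ⇒ₜ b))) ⇔
       (∀ x y z Y Z → T x Y y → T x Z z → T y Z z)
  T7 = mk⇔
    (λ ineq x y z Y Z xYy xZz → by-contradiction λ ¬yZz →
      -- Same instance as for (T4): `xZz` refutes membership of `x` in `a ⇒ₜ b`, the inequality
      -- carries this over to `y`, and failure of `yZz` contradicts it.
      ⇒-elim (ineq _ _ _ λ p → ∁⇒¬T Z p xZz) Y id xYy (¬T⇒∁ Z ¬yZz))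
    (λ cond a b c {x} ¬p → ⇒-intro λ Y _ xYy q → ¬p (⇒-intro λ Z Z⊆a xZz →
      ⇒-elim q Z Z⊆a (cond _ _ _ Y Z xYy xZz)))

  T8 : (∀ a b c → (U ⇒ₜ (∁ a ∪ b)) ∩ (b ⇒ₜ c) ⊆ (a ⇒ₜ c)) ⇔
       (∀ x y Y Z → T x Y y → T x whole ∩ ∣ Y ∣ ⊆ ∣ Z ∣ → T x Z y)
  T8 = mk⇔ to from
    where
    to : (∀ a b c → (U ⇒ₜ (∁ a ∪ b)) ∩ (b ⇒ₜ c) ⊆ (a ⇒ₜ c)) →
         ∀ x y Y Z → T x Y y → T x whole ∩ ∣ Y ∣ ⊆ ∣ Z ∣ → T x Z y
    to ineq x y Y Z xYy xX∩Y⊆Z = by-contradiction λ ¬xZy →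
      -- Instance: `a` is `Y`, `b` is `Z`, `c` the complement of `y`.
      ∁⇒¬T Y (ineq _ _ _ (T⊆⇒ whole split , ¬T⇒∁ Z ¬xZy)) xYy
      where
      split : T x whole ⊆ ∁ ∣ Y ∣ ∪ ∣ Z ∣
      split {w} xXw with em₀ {w ∈ ∣ Y ∣}
      ... | yes w∈Y = inj₂ (xX∩Y⊆Z (xXw , w∈Y))
      ... | no  w∉Y = inj₁ w∉Y

    from : (∀ x y Y Z → T x Y y → T x whole ∩ ∣ Y ∣ ⊆ ∣ Z ∣ → T x Z y) →
           ∀ a b c → (U ⇒ₜ (∁ a ∪ b)) ∩ (b ⇒ₜ c) ⊆ (a ⇒ₜ c)
    from cond a b c {x} (p , q) = ⇒-intro λ Y Y⊆a {y} xYy →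
      let
        -- The least set the condition allows for this `Y`; it is closed by (T1), and `p` forces it
        -- into `b`.
        Z : ClosedSet
        Z = T x whole ∩ ∣ Y ∣ ,
            ∩-closed em₀ topologicalSpace (T-closed x whole) (proj₂ Y)

        Z⊆b : ∣ Z ∣ ⊆ b
        Z⊆b (xXw , w∈Y) = resolve (⇒-elim p whole id xXw) (Y⊆a w∈Y)
      in ⇒-elim q Z Z⊆b (cond x y Y Z xYy id)
      where
      resolve : ∀ {w} → w ∈ ∁ a ∪ b → w ∈ a → w ∈ b
      resolve (inj₁ w∉a) w∈a = ⊥-elim (w∉a w∈a)
      resolve (inj₂ w∈b) _   = w∈b

theorem9p9 : ∀ {ℓ} (em : ExcludedMiddle (suc ℓ)) (S : ConditionalSpace em) →
  let open ConditionalSpace S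
      open RawConditionalAlgebra (Cm em S)
  in
  -- (T3*)
  ((∀ a b c → (a ⇒ c) ∧ (b ⇒ c) ≤ (a ∨ b) ⇒ c) ⇔
   (∀ x y Y → Satisfiable ∣ Y ∣ → T x Y y → ∃ λ z → z ∈ ∣ Y ∣ × T x (singleton z) y))
  ×
  -- (T4)
  ((∀ a b c → a ⇒ b ≤ c ⇒ (a ⇒ b)) ⇔
   (∀ x y z Y Z → T x Y y → T y Z z → T x Z z))
  ×
  -- (T5)
  ((∀ a b → a ∧ (a ⇒ b) ≤ b) ⇔
   (∀ x → T x (singleton x) x))
  ×
  -- (T6)
  ((∀ a b → a ⇒ b ≤ ¬ b ⇒ ¬ a) ⇔
   (∀ x y Y → T x Y y → ∃ λ z → z ∈ ∣ Y ∣ × T x (singleton y) z))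
  ×
  -- (T7)
  ((∀ a b c → ¬ (a ⇒ b) ≤ c ⇒ ¬ (a ⇒ b)) ⇔
   (∀ x y z Y Z → T x Y y → T x Z z → T y Z z))
  ×
  -- (T8)
  ((∀ a b c → (𝟏 ⇒ (¬ a ∨ b)) ∧ (b ⇒ c) ≤ a ⇒ c) ⇔
   (∀ x y Y Z → T x Y y → T x whole ∩ ∣ Y ∣ ⊆ ∣ Z ∣ → T x Z y))
theorem9p9 em S = T3* em S , T4 em S , T5 em S , T6 em S , T7 em S , T8 em S
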